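{- If $D$ and $E$ are continuous dcpos with bases $B_D$ and $B_E$, then $B_D\times B_E$ is a basis for the product $D\times E$. Moreover: (1) if $D$ and $E$ are pointed and for every $b\in B_D$ it is decidable whether $b=\bot$, and for every $b\in B_E$ it is decidable whether $b=\bot$, then for every $b\in B_D\times B_E$ it is decidable whether $b=\bot$; (2) if for every two elements $a,b$ of $B_D$ it is decidable whether $a\ll b$, and likewise for $B_E$, then for every two elements $a,b$ of $B_D\times B_E$ it is decidable whether $a\ll b$ in $D\times E$; (3) if for every two elements $a,b$ of $B_D$ it is decidable whether $a\sqsubseteq b$, and likewise for $B_E$, then for every two elements $a,b$ of $B_D\times B_E$ it is decidable whether $a\sqsubseteq b$ in $D\times E$.
   Context: Everything is constructive: neither excluded middle nor choice is assumed. A proposition $P$ is decidable if $P\vee\lnot P$ holds. A subset $S$ of a poset is directed if it is inhabited and any two elements of $S$ have an upper bound in $S$. A dcpo is a poset $(D,\sqsubseteq)$ in which every directed subset $S$ has a supremum $\bigsqcup S$; it is pointed if it has a least element $\bot$. Write $x\ll y$ ($x$ is way below $y$) if for every directed $S$ with $y\sqsubseteq\bigsqcup S$ there is $s\in S$ with $x\sqsubseteq s$. $D$ is continuous if for every $x$ the set $\{y\in D\mid y\ll x\}$ is directed with supremum $x$. A basis of a dcpo $D$ is a subset $B\subseteq D$ such that for every $x\in D$ the set $\{b\in B\mid b\ll x\}$ is directed with supremum $x$. The product $D\times E$ of dcpos is the Cartesian product with the componentwise order; directed suprema are computed componentwise. -}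

module Defs where

open import Level using (Level; suc; _⊔_)
open import Data.Product using (_×_; _,_; ∃; proj₁; proj₂)
open import Data.Product.Relation.Binary.Pointwise.NonDependent using (×-poset)
open import Relation.Binary.Bundles using (Poset)
open import Relation.Binary.Definitions using (Minimum; _Respects_)
open import Relation.Unary using (Pred; _∈_; _∩_; _⟨×⟩_; Satisfiable)

-- The equality of a poset is its setoid equality _≈_, so a subset is a
-- predicate that is invariant under _≈_.
record Subset {c ℓ₁ ℓ₂} (P : Poset c ℓ₁ ℓ₂) (s : Level) : Set (c ⊔ ℓ₁ ⊔ suc s) where
  open Poset P
  field
    pred : Pred Carrier s
    resp : pred Respects _≈_

open Subset public

-- Directedness and suprema are defined for predicates of any level, because
-- { y ∣ y ≪ x } lives one universe above the subsets quantified over in ≪.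
module _ {c ℓ₁ ℓ₂} (P : Poset c ℓ₁ ℓ₂) where
  open Poset P

  record IsDirected {s} (S : Pred Carrier s) : Set (c ⊔ ℓ₂ ⊔ s) where
    field
      inhabited  : Satisfiable S
      upperBound : ∀ {x y} → x ∈ S → y ∈ S → ∃ λ z → z ∈ S × x ≤ z × y ≤ z

  record IsSupremum {s} (S : Pred Carrier s) (u : Carrier) : Set (c ⊔ ℓ₂ ⊔ s) where
    field
      isUpperBound : ∀ {x} → x ∈ S → x ≤ u
      isLeast      : ∀ v → (∀ {x} → x ∈ S → x ≤ v) → u ≤ v

-- The carrier, the relations and the subsets share one universe level, so that
-- the projections of a subset of a product are again subsets of that level.
record DCPO (ℓ : Level) : Set (suc ℓ) where
  field
    poset : Poset ℓ ℓ ℓ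

  open Poset poset public
    using (Carrier; _≈_)
    renaming (_≤_ to _⊑_)

  field
    ⨆   : (S : Subset poset ℓ) → IsDirected poset (pred S) → Carrier
    ⨆-isSupremum : ∀ S (dir : IsDirected poset (pred S)) →
                   IsSupremum poset (pred S) (⨆ S dir)

  infix 4 _≪_
  _≪_ : Carrier → Carrier → Set (suc ℓ)
  x ≪ y = ∀ (S : Subset poset ℓ) (dir : IsDirected poset (pred S)) →
          y ⊑ ⨆ S dir → ∃ λ s → s ∈ pred S × x ⊑ s

module _ {ℓ} (D : DCPO ℓ) where
  open DCPO D

  IsContinuous : Set (suc ℓ)
  IsContinuous = ∀ x → IsDirected poset (_≪ x) × IsSupremum poset (_≪ x) x

  IsBasis : ∀ {b} → Subset poset b → Set (suc ℓ ⊔ b)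
  IsBasis B = ∀ x → IsDirected poset (pred B ∩ (_≪ x)) ×
                    IsSupremum poset (pred B ∩ (_≪ x)) x

  record Pointed : Set ℓ where
    field
      ⊥       : Carrier
      ⊥-least : Minimum _⊑_ ⊥

module _ {c₁ c₂ ℓ₁ ℓ₂ ℓ₃ ℓ₄}
         {P : Poset c₁ ℓ₁ ℓ₂} {Q : Poset c₂ ℓ₃ ℓ₄} where
  private
    module P = Poset P
    module Q = Poset Q

  infixr 2 _×ˢ_
  _×ˢ_ : ∀ {s t} → Subset P s → Subset Q t → Subset (×-poset P Q) (s ⊔ t)
  pred (A ×ˢ B) = pred A ⟨×⟩ pred B
  resp (A ×ˢ B) (x≈x′ , y≈y′) (a , b) = resp A x≈x′ a , resp B y≈y′ b

  image₁ : ∀ {s} → Subset (×-poset P Q) s → Subset P (c₂ ⊔ s)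
  pred (image₁ S) x = ∃ λ y → (x , y) ∈ pred S
  resp (image₁ S) x≈x′ (y , p) = y , resp S (x≈x′ , Q.Eq.refl) p

  image₂ : ∀ {s} → Subset (×-poset P Q) s → Subset Q (c₁ ⊔ s)
  pred (image₂ S) y = ∃ λ x → (x , y) ∈ pred S
  resp (image₂ S) y≈y′ (x , p) = x , resp S (P.Eq.refl , y≈y′) p

  module _ {s} (S : Subset (×-poset P Q) s)
           (dir : IsDirected (×-poset P Q) (pred S)) where
    open IsDirected

    image₁-directed : IsDirected P (pred (image₁ S))
    inhabited image₁-directed with inhabited dir
    ... | (x , y) , p = x , y , p
    upperBound image₁-directed (_ , p) (_ , q) with upperBound dir p q
    ... | (z , w) , r , (x≤z , _) , (y≤z , _) = z , (w , r) , x≤z , y≤z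

    image₂-directed : IsDirected Q (pred (image₂ S))
    inhabited image₂-directed with inhabited dir
    ... | (x , y) , p = y , x , p
    upperBound image₂-directed (_ , p) (_ , q) with upperBound dir p q
    ... | (z , w) , r , (_ , x≤w) , (_ , y≤w) = w , (z , r) , x≤w , y≤w

module _ {ℓ} (D E : DCPO ℓ) where
  private
    module D = DCPO D
    module E = DCPO E
  open IsSupremum

  infixr 2 _×ᵈ_
  _×ᵈ_ : DCPO ℓ
  DCPO.poset _×ᵈ_ = ×-poset D.poset E.poset
  DCPO.⨆ _×ᵈ_ S dir = D.⨆ (image₁ S) (image₁-directed S dir)
                    , E.⨆ (image₂ S) (image₂-directed S dir)
  DCPO.⨆-isSupremum _×ᵈ_ S dir = record
    { isUpperBound = λ {(x , y)} p →
        isUpperBound sup₁ (y , p) , isUpperBound sup₂ (x , p)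
    ; isLeast = λ (u , v) ub →
        isLeast sup₁ u (λ (_ , p) → proj₁ (ub p)) ,
        isLeast sup₂ v (λ (_ , p) → proj₂ (ub p))
    }
    where
    sup₁ = D.⨆-isSupremum (image₁ S) (image₁-directed S dir)
    sup₂ = E.⨆-isSupremum (image₂ S) (image₂-directed S dir)

×-pointed : ∀ {ℓ} {D E : DCPO ℓ} → Pointed D → Pointed E → Pointed (D ×ᵈ E)
×-pointed p q = record
  { ⊥       = Pointed.⊥ p , Pointed.⊥ q
  ; ⊥-least = λ (x , y) → Pointed.⊥-least p x , Pointed.⊥-least q y
  }

{-# OPTIONS --safe #-}
-- The way-below relation of a product is componentwise: an upper bound in S of
-- two elements witnessing the components witnesses the pair, and conversely
-- ≪ in D × E is tested on S × {y}, whose supremum is (⨆ S , y). So the basis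
-- elements way below (x , y) form a product of two directed subsets, whose
-- supremum is computed componentwise because both factors are inhabited.
module Submission where

open import Defs
open import Level using (Level)
open import Data.Product using (_×_; _,_; proj₁; proj₂; map; zip)
open import Data.Product.Relation.Binary.Pointwise.NonDependent using (×-poset)
open import Function using (id)
open import Relation.Binary.Bundles using (Poset)
open import Relation.Nullary using (Dec)
open import Relation.Nullary.Decidable using (map′; _×-dec_)
open import Relation.Unary using (Pred; _∈_; _≐_; _∩_; _⟨×⟩_)

open IsDirected
open IsSupremum

module _ {c ℓ₁ ℓ₂} (P : Poset c ℓ₁ ℓ₂) {s t} {S : Pred (Poset.Carrier P) s}
         {T : Pred (Poset.Carrier P) t} where

  -- The basis elements way below a pair and the product of the two factor sets are distinct
  -- predicates that contain each other, so directedness and suprema are carried across `≐`.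
  directed-resp-≐ : S ≐ T → IsDirected P S → IsDirected P T
  inhabited (directed-resp-≐ (S⊆T , _) dir) = map id S⊆T (inhabited dir)
  upperBound (directed-resp-≐ (S⊆T , T⊆S) dir) p q
    with upperBound dir (T⊆S p) (T⊆S q)
  ... | z , r , x≤z , y≤z = z , S⊆T r , x≤z , y≤z

  supremum-resp-≐ : ∀ {u} → S ≐ T → IsSupremum P S u → IsSupremum P T u
  isUpperBound (supremum-resp-≐ (_ , T⊆S) sup) p = isUpperBound sup (T⊆S p)
  isLeast (supremum-resp-≐ (S⊆T , _) sup) v ub =
    isLeast sup v (λ p → ub (S⊆T p))

module _ {c ℓ₁ ℓ₂} (P : Poset c ℓ₁ ℓ₂) where
  open Poset P

  -- Membership is `_≈_`, which gives the invariance `resp` asks for; in a dcpo its level is that of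
  -- the subsets tested by `≪`.
  singleton : Carrier → Subset P ℓ₁
  pred (singleton x) y = x ≈ y
  resp (singleton x) y≈z x≈y = Eq.trans x≈y y≈z

  singleton-directed : ∀ x → IsDirected P (pred (singleton x))
  inhabited (singleton-directed x) = x , Eq.refl
  upperBound (singleton-directed x) x≈y x≈z =
    x , Eq.refl , reflexive (Eq.sym x≈y) , reflexive (Eq.sym x≈z)

module _ {c₁ c₂ ℓ₁ ℓ₂ ℓ₃ ℓ₄} (P : Poset c₁ ℓ₁ ℓ₂) (Q : Poset c₂ ℓ₃ ℓ₄)
         {s t} {S : Pred (Poset.Carrier P) s} {T : Pred (Poset.Carrier Q) t}
         (dirS : IsDirected P S) (dirT : IsDirected Q T) where

  ×-directed : IsDirected (×-poset P Q) (S ⟨×⟩ T)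
  inhabited ×-directed = zip _,_ _,_ (inhabited dirS) (inhabited dirT)
  upperBound ×-directed (p , q) (p′ , q′)
    with upperBound dirS p p′ | upperBound dirT q q′
  ... | z , r , x≤z , x′≤z | w , r′ , y≤w , y′≤w =
    (z , w) , (r , r′) , (x≤z , y≤w) , (x′≤z , y′≤w)

  ×-supremum : ∀ {u v} → IsSupremum P S u → IsSupremum Q T v →
               IsSupremum (×-poset P Q) (S ⟨×⟩ T) (u , v)
  isUpperBound (×-supremum supS supT) =
    map (isUpperBound supS) (isUpperBound supT)
  isLeast (×-supremum supS supT) (u , v) ub =
    -- `ub` speaks only of pairs, so an inhabitant of the other factor fills the free coordinate.
    isLeast supS u (λ p → proj₁ (ub (p , proj₂ (inhabited dirT)))) ,
    isLeast supT v (λ q → proj₂ (ub (proj₂ (inhabited dirS) , q)))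

module _ {ℓ} (D E : DCPO ℓ) where
  private
    module D where
      open DCPO D public
      open Poset poset public using (trans; module Eq)
    module E where
      open DCPO E public
      open Poset poset public using (trans; module Eq)
    module D×E = DCPO (D ×ᵈ E)

  ×-≪ : ∀ {x x′ y y′} → x D.≪ x′ → y E.≪ y′ → (x , y) D×E.≪ (x′ , y′)
  ×-≪ x≪x′ y≪y′ S dir (x′⊑⨆ , y′⊑⨆)
    with x≪x′ (image₁ S) (image₁-directed S dir) x′⊑⨆
       | y≪y′ (image₂ S) (image₂-directed S dir) y′⊑⨆
  -- `p` and `q` place `s` and `t` in pairs of `S` whose other coordinates are arbitrary; an upper
  -- bound of these two pairs dominates `s` on the left and `t` on the right.
  ... | _ , (_ , p) , x⊑s | _ , (_ , q) , y⊑t with upperBound dir p q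
  ... | u , r , (s⊑u , _) , (_ , t⊑u) =
    u , r , D.trans x⊑s s⊑u , E.trans y⊑t t⊑u

  ≪-proj₁ : ∀ {x x′ y y′} → (x , y) D×E.≪ (x′ , y′) → x D.≪ x′
  ≪-proj₁ {y′ = y′} xy≪ S dir x′⊑⨆
    with xy≪ (S ×ˢ singleton E.poset y′) dir′ (x′⊑ , y′⊑)
    where
    dir′ = ×-directed D.poset E.poset dir (singleton-directed E.poset y′)
    sup  = D×E.⨆-isSupremum (S ×ˢ singleton E.poset y′) dir′
    -- The first component of the product supremum bounds every element of `S`, each paired with
    -- `y′`, hence lies above the supremum of `S`.
    x′⊑  = D.trans x′⊑⨆ (isLeast (D.⨆-isSupremum S dir) _
             (λ p → proj₁ (isUpperBound sup (p , E.Eq.refl))))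
    -- Some element of `S` is needed to make `y′` a coordinate of a member of the test set.
    y′⊑  = proj₂ (isUpperBound sup (proj₂ (inhabited dir) , E.Eq.refl))
  ... | (s , _) , (p , _) , (x⊑s , _) = s , p , x⊑s

  -- Mirror image of `≪-proj₁`, with the singleton of `x′` as the left factor of the test set.
  ≪-proj₂ : ∀ {x x′ y y′} → (x , y) D×E.≪ (x′ , y′) → y E.≪ y′
  ≪-proj₂ {x′ = x′} xy≪ S dir y′⊑⨆
    with xy≪ (singleton D.poset x′ ×ˢ S) dir′ (x′⊑ , y′⊑)
    where
    dir′ = ×-directed D.poset E.poset (singleton-directed D.poset x′) dir
    sup  = D×E.⨆-isSupremum (singleton D.poset x′ ×ˢ S) dir′
    x′⊑  = proj₁ (isUpperBound sup (D.Eq.refl , proj₂ (inhabited dir)))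
    y′⊑  = E.trans y′⊑⨆ (isLeast (E.⨆-isSupremum S dir) _
             (λ p → proj₂ (isUpperBound sup (D.Eq.refl , p))))
  ... | (_ , t) , (_ , q) , (_ , y⊑t) = t , q , y⊑t

  ×-isBasis : ∀ {b₁ b₂} (A : Subset D.poset b₁) (B : Subset E.poset b₂) →
              IsBasis D A → IsBasis E B → IsBasis (D ×ᵈ E) (A ×ˢ B)
  ×-isBasis A B basisA basisB (x , y) with basisA x | basisB y
  ... | dirA , supA | dirB , supB =
    directed-resp-≐ D×E.poset ≪-≐
      (×-directed D.poset E.poset dirA dirB) ,
    supremum-resp-≐ D×E.poset ≪-≐
      (×-supremum D.poset E.poset dirA dirB supA supB)
    where
    -- Once `≪` splits into components, both sides are the same four conditions, grouped by factor
    -- or by kind.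
    ≪-≐ : ((pred A ∩ (D._≪ x)) ⟨×⟩ (pred B ∩ (E._≪ y))) ≐
          (pred (A ×ˢ B) ∩ (D×E._≪ (x , y)))
    ≪-≐ = (λ ((a , a≪x) , (b , b≪y)) → (a , b) , ×-≪ a≪x b≪y) ,
          (λ ((a , b) , ab≪) → (a , ≪-proj₁ ab≪) , (b , ≪-proj₂ ab≪))

proposition2p23 :
  ∀ {ℓ b₁ b₂ : Level} (D E : DCPO ℓ) →
  let module D = DCPO D
      module E = DCPO E
      module D×E = DCPO (D ×ᵈ E)
  in
  IsContinuous D → IsContinuous E →
  (B-D : Subset D.poset b₁) (B-E : Subset E.poset b₂) →
  IsBasis D B-D → IsBasis E B-E →
  IsBasis (D ×ᵈ E) (B-D ×ˢ B-E)
  × ((pD : Pointed D) (pE : Pointed E) →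
     (∀ b → b ∈ pred B-D → Dec (b D.≈ Pointed.⊥ pD)) →
     (∀ b → b ∈ pred B-E → Dec (b E.≈ Pointed.⊥ pE)) →
     ∀ b → b ∈ pred (B-D ×ˢ B-E) →
     Dec (b D×E.≈ Pointed.⊥ (×-pointed {D = D} {E = E} pD pE)))
  × ((∀ a b → a ∈ pred B-D → b ∈ pred B-D → Dec (a D.≪ b)) →
     (∀ a b → a ∈ pred B-E → b ∈ pred B-E → Dec (a E.≪ b)) →
     ∀ a b → a ∈ pred (B-D ×ˢ B-E) → b ∈ pred (B-D ×ˢ B-E) →
     Dec (a D×E.≪ b))
  × ((∀ a b → a ∈ pred B-D → b ∈ pred B-D → Dec (a D.⊑ b)) →
     (∀ a b → a ∈ pred B-E → b ∈ pred B-E → Dec (a E.⊑ b)) →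
     ∀ a b → a ∈ pred (B-D ×ˢ B-E) → b ∈ pred (B-D ×ˢ B-E) →
     Dec (a D×E.⊑ b))
proposition2p23 D E _ _ B-D B-E basisD basisE =
  ×-isBasis D E B-D B-E basisD basisE ,
  -- Equality in the product, like its order below, is by definition a pair of component relations,
  -- so `×-dec` decides it directly.
  (λ _ _ ≟⊥₁ ≟⊥₂ (x , y) (p , q) → ≟⊥₁ x p ×-dec ≟⊥₂ y q) ,
  (λ ≪?₁ ≪?₂ (x , y) (x′ , y′) (p , q) (p′ , q′) →
     -- `≪` in the product quantifies over directed subsets of pairs, so the componentwise decision
     -- is transferred along the equivalence.
     map′ (λ (x≪x′ , y≪y′) → ×-≪ D E x≪x′ y≪y′)
          (λ xy≪ → ≪-proj₁ D E xy≪ , ≪-proj₂ D E xy≪)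
          (≪?₁ x x′ p p′ ×-dec ≪?₂ y y′ q q′)) ,
  (λ ⊑?₁ ⊑?₂ (x , y) (x′ , y′) (p , q) (p′ , q′) →
     ⊑?₁ x x′ p p′ ×-dec ⊑?₂ y y′ q q′)
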